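{- For every $d\le 20$, the $d$-dimensional cube $Q^d$ is stackable.
   Context: $Q^d$ has vertex set $\{0,1\}^d$, two vertices adjacent when they differ in exactly one coordinate. A configuration is a function $C:V(G)\to\mathbb{N}$ (numbers of cups). A cup stacking move from $u$ to $v$ is allowed when $C(u)\ge1$, $C(v)\ge1$ and $\mathrm{dist}_G(u,v)=C(u)$; it moves all cups of $u$ onto $v$. Let $\mathbf{1}$ be the configuration with one cup on every vertex. $G$ is $r$-stackable if some sequence of moves from $\mathbf{1}$ puts all cups on $r$, and stackable if it is $r$-stackable for every vertex $r$. -}

module Defs where

open import Data.Nat using (ℕ; zero; suc; _+_; _≤_)
open import Data.Bool using (Bool; true; false; if_then_else_)
import Data.Bool as B
open import Data.Vec using (Vec; []; _∷_)
open import Data.Vec.Properties using (≡-dec)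
open import Data.Product using (_×_)
open import Relation.Nullary using (¬_; does)
open import Relation.Binary.PropositionalEquality using (_≡_)

Vertex : ℕ → Set
Vertex d = Vec Bool d

_≟V_ : ∀ {d} (u v : Vertex d) → Relation.Nullary.Dec (u ≡ v)
_≟V_ = ≡-dec B._≟_

-- Graph distance in Q^d: the number of coordinates in which u and v differ
-- (Hamming distance; this is the shortest-path distance in Q^d).
dist : ∀ {d} → Vertex d → Vertex d → ℕ
dist []       []       = 0
dist (x ∷ xs) (y ∷ ys) = (if does (x B.≟ y) then 0 else 1) + dist xs ys

-- A configuration: number of cups on each vertex.
Config : ℕ → Set
Config d = Vertex d → ℕ

𝟏 : ∀ {d} → Config d
𝟏 _ = 1

Legal : ∀ {d} → Config d → Vertex d → Vertex d → Set
Legal C u v = (1 ≤ C u) × (1 ≤ C v) × (dist u v ≡ C u)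

-- Result of moving all cups of u onto v (u ≠ v whenever the move is legal).
move : ∀ {d} → Config d → Vertex d → Vertex d → Config d
move C u v w =
  if does (w ≟V u) then 0
  else (if does (w ≟V v) then C v + C u else C w)

AllOn : ∀ {d} → Vertex d → Config d → Set
AllOn r C = ∀ w → ¬ (w ≡ r) → C w ≡ 0

data StacksTo {d : ℕ} (r : Vertex d) : Config d → Set where
  done : ∀ {C} → AllOn r C → StacksTo r C
  step : ∀ {C} (u v : Vertex d) → Legal C u v → StacksTo r (move C u v) → StacksTo r C

RStackable : (d : ℕ) → Vertex d → Set
RStackable d r = StacksTo r (𝟏 {d})

Stackable : ℕ → Set
Stackable d = (r : Vertex d) → RStackable d r

-- Call the pair (i , n) clearable when every n-dimensional subcube all of whose
-- vertices w are at distance i + |w| from the root, with one cup on each vertex,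
-- can be emptied onto the root.  Cutting a subcube into two facets shows that
-- (i , n) is clearable if (i , n - 1) and (i + 1 , n - 1) are, and Q^d is
-- stackable if (0 , d) is clearable.  A subcube is cleared directly by
-- partitioning it into groups, each gathered onto a vertex w where it forms a
-- pile of exactly i + |w| cups.  Such partitions in dimension at most 6 supply
-- (i , 6) for all i ≤ 14, and cutting then gives (0 , d) for 6 ≤ d ≤ 20.
module Submission where

open import Defs
open import Data.Nat using (ℕ; zero; suc; _+_; _∸_; _≤_; z≤n; s≤s; _≤?_)
open import Data.Nat.Properties
  using (+-suc; n≢0⇒n>0; ≰⇒>; ≤-trans; m≤m+n; m∸n+n≡m; m≤n+o⇒m∸n≤o; <⇒≤)
  renaming (_≟_ to _≟ℕ_)
open import Data.Nat.DivMod using (_/_; _%_)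
open import Data.Bool using (true; false; if_then_else_; _xor_)
open import Data.Vec using ([]; _∷_; replicate; zipWith)
open import Data.List using (List; []; _∷_; map)
open import Data.Product using (_×_; _,_; ∃)
open import Data.Fin.Subset.Properties using (anySubset?)
open import Function using (_∘_)
open import Relation.Nullary using (¬_; Dec; yes; no; does; contradiction; ¬?; _×-dec_)
open import Relation.Nullary.Decidable using (True; decidable-stable; toWitness)
open import Relation.Binary.PropositionalEquality
  using (_≡_; _≢_; refl; sym; trans; cong; cong₂; subst; ≢-sym)

-- Hamming distance and translations of the cube.

dist-refl : ∀ {n} (v : Vertex n) → dist v v ≡ 0
dist-refl []          = refl
dist-refl (false ∷ v) = dist-refl v
dist-refl (true  ∷ v) = dist-refl v

dist≡0⇒≡ : ∀ {n} (u v : Vertex n) → dist u v ≡ 0 → u ≡ v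
dist≡0⇒≡ []          []          _ = refl
dist≡0⇒≡ (false ∷ u) (false ∷ v) p = cong (false ∷_) (dist≡0⇒≡ u v p)
dist≡0⇒≡ (true  ∷ u) (true  ∷ v) p = cong (true ∷_) (dist≡0⇒≡ u v p)

weight : ∀ {n} → Vertex n → ℕ
weight w = dist w (replicate _ false)

infixl 6 _⊕_
_⊕_ : ∀ {n} → Vertex n → Vertex n → Vertex n
_⊕_ = zipWith _xor_

⊕-cancelˡ : ∀ {n} (r w : Vertex n) → r ⊕ (r ⊕ w) ≡ w
⊕-cancelˡ []          []          = refl
⊕-cancelˡ (false ∷ r) (y ∷ w)     = cong (y ∷_) (⊕-cancelˡ r w)
⊕-cancelˡ (true  ∷ r) (false ∷ w) = cong (false ∷_) (⊕-cancelˡ r w)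
⊕-cancelˡ (true  ∷ r) (true  ∷ w) = cong (true ∷_) (⊕-cancelˡ r w)

dist-⊕ : ∀ {n} (r u v : Vertex n) → dist (r ⊕ u) (r ⊕ v) ≡ dist u v
dist-⊕ []          []          []          = refl
dist-⊕ (false ∷ r) (x ∷ u)     (y ∷ v)     = cong (_ +_) (dist-⊕ r u v)
dist-⊕ (true  ∷ r) (false ∷ u) (false ∷ v) = dist-⊕ r u v
dist-⊕ (true  ∷ r) (false ∷ u) (true  ∷ v) = cong suc (dist-⊕ r u v)
dist-⊕ (true  ∷ r) (true  ∷ u) (false ∷ v) = cong suc (dist-⊕ r u v)
dist-⊕ (true  ∷ r) (true  ∷ u) (true  ∷ v) = dist-⊕ r u v

dist-⊕-weight : ∀ {n} (r w : Vertex n) → dist (r ⊕ w) r ≡ weight w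
dist-⊕-weight []          []          = refl
dist-⊕-weight (false ∷ r) (y ∷ w)     = cong (_ +_) (dist-⊕-weight r w)
dist-⊕-weight (true  ∷ r) (false ∷ w) = dist-⊕-weight r w
dist-⊕-weight (true  ∷ r) (true  ∷ w) = cong suc (dist-⊕-weight r w)

module _ {d} (C : Config d) where

  move-source : ∀ u v → move C u v u ≡ 0
  move-source u v with u ≟V u
  ... | yes _  = refl
  ... | no u≢u = contradiction refl u≢u

  move-target : ∀ {u v} → v ≢ u → move C u v v ≡ C v + C u
  move-target {u} {v} v≢u with v ≟V u | v ≟V v
  ... | yes v≡u | _      = contradiction v≡u v≢u
  ... | no _    | yes _  = refl
  ... | no _    | no v≢v = contradiction refl v≢v

  move-other : ∀ {u v w} → w ≢ u → w ≢ v → move C u v w ≡ C w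
  move-other {u} {v} {w} w≢u w≢v with w ≟V u | w ≟V v
  ... | yes w≡u | _       = contradiction w≡u w≢u
  ... | no _    | yes w≡v = contradiction w≡v w≢v
  ... | no _    | no _    = refl

-- Subcubes and clearability.

record Subcube {d} (root : Vertex d) (i n : ℕ) : Set where
  field
    at       : Vertex n → Vertex d
    isometry : ∀ u v → dist (at u) (at v) ≡ dist u v
    -- The zero vector is the corner nearest the root, so the root can lie in the subcube only if
    -- `i` is 0.
    level    : ∀ w → dist (at w) root ≡ i + weight w

  Outside : Vertex d → Set
  Outside x = ∀ w → at w ≢ x

  at-injective : ∀ {u v} → at u ≡ at v → u ≡ v
  at-injective {u} {v} eq = dist≡0⇒≡ u v
    (trans (sym (isometry u v)) (trans (cong (dist (at u)) (sym eq)) (dist-refl (at u))))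

  positive⇒≢root : ∀ {w} → 1 ≤ i + weight w → at w ≢ root
  positive⇒≢root {w} p eq
    with () ← subst (1 ≤_)
      (trans (sym (level w)) (trans (cong (dist (at w)) (sym eq)) (dist-refl (at w)))) p

  ≢root⇒positive : ∀ {w} → at w ≢ root → 1 ≤ i + weight w
  ≢root⇒positive {w} w≢r =
    n≢0⇒n>0 λ z → w≢r (dist≡0⇒≡ (at w) root (trans (level w) z))


open Subcube

-- The final height of the root pile is left open: a later move onto the root asks only for one cup
-- there. `undisturbed` lets disjoint subcubes be cleared one after another.
record Emptied {d} {root : Vertex d} {i n} (S : Subcube root i n) (C C′ : Config d) : Set where
  field
    root-kept   : 1 ≤ C′ root
    emptied     : ∀ w → at S w ≢ root → C′ (at S w) ≡ 0
    undisturbed : ∀ {x} → Outside S x → x ≢ root → C′ x ≡ C x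

open Emptied

-- The root may itself lie in the subcube (when i ≡ 0); its cups are ignored.
Clearable : ℕ → ℕ → Set
Clearable i n = ∀ {d} {root : Vertex d} (S : Subcube root i n) (C : Config d) →
  1 ≤ C root →
  (∀ w → at S w ≢ root → C (at S w) ≡ 1) →
  (∀ C′ → Emptied S C C′ → StacksTo root C′) →
  StacksTo root C

lowerFacet : ∀ {d} {root : Vertex d} {i n} → Subcube root i (suc n) → Subcube root i n
lowerFacet S = record
  { at       = at S ∘ (false ∷_)
  ; isometry = λ u v → isometry S (false ∷ u) (false ∷ v)
  ; level    = λ w → level S (false ∷ w)
  }

upperFacet : ∀ {d} {root : Vertex d} {i n} → Subcube root i (suc n) → Subcube root (suc i) n
upperFacet {i = i} S = record
  { at       = at S ∘ (true ∷_)
  ; isometry = λ u v → isometry S (true ∷ u) (true ∷ v)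
  ; level    = λ w → trans (level S (true ∷ w)) (+-suc i (weight w))
  }

cut : ∀ {i n} → Clearable i n → Clearable (suc i) n → Clearable i (suc n)
cut lower upper S C root≥1 ones continue =
  upper (upperFacet S) C root≥1 (λ w → ones (true ∷ w)) λ C₁ e₁ →
  lower (lowerFacet S) C₁ (root-kept e₁)
    (λ w w≢r → trans (undisturbed e₁ (upper≢lower w) w≢r) (ones (false ∷ w) w≢r)) λ C₂ e₂ →
  continue C₂ record
    { root-kept   = root-kept e₂
    ; emptied     = λ { (false ∷ w) w≢r → emptied e₂ w w≢r
                      ; (true ∷ w)  w≢r → trans (undisturbed e₂ (lower≢upper w) w≢r) (emptied e₁ w w≢r) }
    ; undisturbed = λ out x≢r → trans (undisturbed e₂ (out ∘ (false ∷_)) x≢r)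
                                      (undisturbed e₁ (out ∘ (true ∷_)) x≢r)
    }
  where
  upper≢lower : ∀ w w′ → at S (true ∷ w′) ≢ at S (false ∷ w)
  upper≢lower w w′ eq with () ← at-injective S eq

  lower≢upper : ∀ w w′ → at S (false ∷ w′) ≢ at S (true ∷ w)
  lower≢upper w w′ eq with () ← at-injective S eq

-- Scripts in local coordinates, checked by evaluation.

data Step (n : ℕ) : Set where
  push   : Vertex n → Vertex n → Step n
  retire : Vertex n → Step n

-- Local effect of a move onto the root, whose true pile the local configuration does not track.
remove : ∀ {n} → Config n → Vertex n → Config n
remove L v w = if does (w ≟V v) then 0 else L w

-- The bounds `1 ≤ i + weight` keep pushes off the root. For a retired `v`, `i + weight v` is its
-- distance to the root, so the equation is the legality of moving its pile there.
Plays : ∀ {n} → ℕ → List (Step n) → Config n → Set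
Plays i []             L = ¬ ∃ λ w → 1 ≤ i + weight w × L w ≢ 0
Plays i (push u v ∷ s) L =
  (1 ≤ i + weight u × 1 ≤ i + weight v × Legal L u v) × Plays i s (move L u v)
Plays i (retire v ∷ s) L =
  (1 ≤ L v × i + weight v ≡ L v) × Plays i s (remove L v)

plays? : ∀ {n} i (s : List (Step n)) L → Dec (Plays i s L)
-- A subset of an `n`-element set is a Boolean vector, so this searches all vertices of the local
-- cube.
plays? i []             L = ¬? (anySubset? λ w → 1 ≤? i + weight w ×-dec ¬? (L w ≟ℕ 0))
plays? i (push u v ∷ s) L =
  (1 ≤? i + weight u ×-dec 1 ≤? i + weight v ×-dec
   1 ≤? L u ×-dec 1 ≤? L v ×-dec dist u v ≟ℕ L u)
  ×-dec plays? i s (move L u v)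
plays? i (retire v ∷ s) L =
  (1 ≤? L v ×-dec i + weight v ≟ℕ L v) ×-dec plays? i s (remove L v)

module _ {d} {root : Vertex d} {i n} (S : Subcube root i n) where

  Agrees : Config d → Config n → Set
  Agrees C L = ∀ w → at S w ≢ root → C (at S w) ≡ L w

  push-agrees : ∀ {C L u v} → at S u ≢ root → at S v ≢ root → Agrees C L →
                Agrees (move C (at S u) (at S v)) (move L u v)
  push-agrees {C} {L} {u} {v} u≢r v≢r agree w w≢r with w ≟V u
  ... | yes refl = move-source C (at S u) (at S v)
  ... | no w≢u with w ≟V v
  ...   | yes refl = trans (move-target C (w≢u ∘ at-injective S)) (cong₂ _+_ (agree v v≢r) (agree u u≢r))
  ...   | no w≢v = trans (move-other C (w≢u ∘ at-injective S) (w≢v ∘ at-injective S)) (agree w w≢r)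

  retire-agrees : ∀ {C L v} → Agrees C L → Agrees (move C (at S v) root) (remove L v)
  retire-agrees {C} {L} {v} agree w w≢r with w ≟V v
  ... | yes refl = move-source C (at S v) root
  ... | no w≢v   = trans (move-other C (w≢v ∘ at-injective S) w≢r) (agree w w≢r)

  -- The script is replayed in the ambient cube: `isometry` makes pushes legal, `level` makes
  -- retirements legal, and only the subcube and the root are touched.
  playOut : ∀ s {L C} → Plays i s L → Agrees C L → 1 ≤ C root →
            (∀ C′ → Emptied S C C′ → StacksTo root C′) → StacksTo root C
  playOut [] {L} {C} empty agree root≥1 continue = continue C record
    { root-kept   = root≥1
    ; emptied     = λ w w≢r → trans (agree w w≢r)
        (decidable-stable (L w ≟ℕ 0) λ Lw≢0 → empty (w , ≢root⇒positive S w≢r , Lw≢0))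
    ; undisturbed = λ _ _ → refl
    }
  playOut (push u v ∷ s) {L} {C} ((u⁺ , v⁺ , Lu , Lv , duv) , rest) agree root≥1 continue =
    step (at S u) (at S v)
      ( subst (1 ≤_) (sym (agree u u≢r)) Lu
      , subst (1 ≤_) (sym (agree v v≢r)) Lv
      , trans (isometry S u v) (trans duv (sym (agree u u≢r))))
      (playOut s rest (push-agrees {C = C} u≢r v≢r agree)
        (subst (1 ≤_) (sym (move-other C (≢-sym u≢r) (≢-sym v≢r))) root≥1)
        λ C′ e → continue C′ record
          { root-kept   = root-kept e
          ; emptied     = emptied e
          ; undisturbed = λ out x≢r → trans (undisturbed e out x≢r)
                                            (move-other C (≢-sym (out u)) (≢-sym (out v)))
          })
    where
    u≢r = positive⇒≢root S u⁺
    v≢r = positive⇒≢root S v⁺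
  playOut (retire v ∷ s) {L} {C} ((Lv , lv) , rest) agree root≥1 continue =
    step (at S v) root
      ( subst (1 ≤_) (sym (agree v v≢r)) Lv
      , root≥1
      , trans (level S v) (trans lv (sym (agree v v≢r))))
      (playOut s rest (retire-agrees {C = C} agree)
        (subst (1 ≤_) (sym (move-target C (≢-sym v≢r))) (≤-trans root≥1 (m≤m+n _ _)))
        λ C′ e → continue C′ record
          { root-kept   = root-kept e
          ; emptied     = emptied e
          ; undisturbed = λ out x≢r → trans (undisturbed e out x≢r)
                                            (move-other C (≢-sym (out v)) x≢r)
          })
    where
    v≢r = positive⇒≢root S (subst (1 ≤_) (sym lv) Lv)

by : ∀ {i n} (s : List (Step n)) → {True (plays? i s 𝟏)} → Clearable i n
by s {ok} S C root≥1 ones = playOut S s (toWitness ok) ones root≥1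

-- Propagating clearability to higher dimensions.

-- Row n i l : the pairs (i , n), …, (i + l - 1 , n) are clearable.
data Row (n : ℕ) : ℕ → ℕ → Set where
  []  : ∀ {i} → Row n i 0
  _∷_ : ∀ {i l} → Clearable i n → Row n (suc i) l → Row n i (suc l)

cutRow : ∀ {n i l} → Row n i (suc l) → Row (suc n) i l
cutRow (c ∷ [])      = []
cutRow (c ∷ c′ ∷ cs) = cut c c′ ∷ cutRow (c′ ∷ cs)

-- This is `l + i`, with a recursion matching the index of a `Row` tail, so that `_++_` type-checks
-- by computation.
shift : ℕ → ℕ → ℕ
shift zero    i = i
shift (suc l) i = shift l (suc i)

infixr 5 _++_
_++_ : ∀ {n i l m} → Row n i l → Row n (shift l i) m → Row n i (l + m)
[]       ++ ds = ds
(c ∷ cs) ++ ds = c ∷ (cs ++ ds)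

clearable-below : ∀ {n i l} → Row n i (suc l) → ∀ m → m ≤ l → Clearable i (m + n)
clearable-below (c ∷ cs) zero z≤n = c
clearable-below {n} {i} cs (suc m) (s≤s m≤l) =
  subst (Clearable i) (+-suc m n) (clearable-below (cutRow cs) m m≤l)

stackable : ∀ {d} → Clearable 0 d → Stackable d
stackable clear r = clear S 𝟏 (s≤s z≤n) (λ _ _ → refl) λ C e →
  -- The embedding `r ⊕_` is its own inverse, so every `w` is the image of `r ⊕ w`.
  done λ w w≢r → subst (λ x → C x ≡ 0) (⊕-cancelˡ r w)
    (emptied e (r ⊕ w) (w≢r ∘ trans (sym (⊕-cancelˡ r w))))
  where
  S : Subcube r 0 _
  S = record { at = r ⊕_ ; isometry = dist-⊕ r ; level = dist-⊕-weight r }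

-- Explicit gatherings.

-- Vertices are written as numbers in binary, least significant bit first.
bits : ∀ {n} → ℕ → Vertex n
bits {zero}  k = []
bits {suc n} k = does (k % 2 ≟ℕ 1) ∷ bits (k / 2)

infix 6 _⟶_ _↑
_⟶_ : ∀ {n} → ℕ → ℕ → Step n
u ⟶ v = push (bits u) (bits v)

_↑ : ∀ {n} → ℕ → Step n
v ↑ = retire (bits v)

translate : ∀ {n} → Vertex n → Step n → Step n
translate r (push u v) = push (r ⊕ u) (r ⊕ v)
translate r (retire v) = retire (r ⊕ v)

gatherAt : ∀ {n} → List (Step n) → ℕ → List (Step n)
gatherAt s k = map (translate (bits k)) s

-- gatherₙ stacks all of Q^n on 0; translated to a vertex of weight w, it clears
-- (2 ^ n - w , n).
gather₁ : List (Step 1)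
gather₁ =
  1 ⟶ 0 ∷ 0 ↑ ∷ []

gather₂ : List (Step 2)
gather₂ =
  1 ⟶ 0 ∷ 2 ⟶ 3 ∷ 3 ⟶ 0 ∷ 0 ↑ ∷ []

gather₃ : List (Step 3)
gather₃ =
  1 ⟶ 0 ∷ 2 ⟶ 3 ∷ 3 ⟶ 0 ∷ 4 ⟶ 5 ∷ 5 ⟶ 0 ∷ 7 ⟶ 6 ∷ 6 ⟶ 0 ∷ 0 ↑ ∷ []

gather₄ : List (Step 4)
gather₄ =
  1 ⟶ 0 ∷ 2 ⟶ 0 ∷ 11 ⟶ 3 ∷ 3 ⟶ 0 ∷ 4 ⟶ 5 ∷ 5 ⟶ 0 ∷ 7 ⟶ 6 ∷ 6 ⟶ 0 ∷ 14 ⟶ 10 ∷ 10 ⟶ 0 ∷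
  8 ⟶ 12 ∷ 12 ⟶ 0 ∷ 9 ⟶ 13 ∷ 15 ⟶ 13 ∷ 13 ⟶ 0 ∷ 0 ↑ ∷ []

-- The numbers in a script's name are `i` and `n`. Each `↑` closes a group; here the sizes 5, 5 and
-- 6 sum to 16. Within a group single cups go to neighbours, then piles of k cups jump distance k.
script-3-4 : List (Step 4)
script-3-4 =
  7 ⟶ 3 ∷ 10 ⟶ 8 ∷ 12 ⟶ 8 ∷ 8 ⟶ 3 ∷ 3 ↑ ∷
  1 ⟶ 9 ∷ 0 ⟶ 4 ∷ 5 ⟶ 4 ∷ 4 ⟶ 9 ∷ 9 ↑ ∷
  15 ⟶ 13 ∷ 13 ⟶ 11 ∷ 2 ⟶ 6 ∷ 14 ⟶ 6 ∷ 6 ⟶ 11 ∷ 11 ↑ ∷ []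

script-4-4 : List (Step 4)
script-4-4 =
  2 ⟶ 0 ∷ 8 ⟶ 12 ∷ 12 ⟶ 0 ∷ 0 ↑ ∷
  1 ⟶ 3 ∷ 7 ⟶ 6 ∷ 6 ⟶ 3 ∷ 14 ⟶ 10 ∷ 10 ⟶ 3 ∷ 3 ↑ ∷
  13 ⟶ 9 ∷ 4 ⟶ 5 ∷ 5 ⟶ 9 ∷ 11 ⟶ 15 ∷ 15 ⟶ 9 ∷ 9 ↑ ∷ []

script-7-5 : List (Step 5)
script-7-5 =
  15 ⟶ 7 ∷ 7 ⟶ 14 ∷ 13 ⟶ 29 ∷ 31 ⟶ 29 ∷ 29 ⟶ 14 ∷ 0 ⟶ 1 ∷ 3 ⟶ 1 ∷ 9 ⟶ 1 ∷ 1 ⟶ 14 ∷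
  14 ↑ ∷
  21 ⟶ 23 ∷ 28 ⟶ 20 ∷ 20 ⟶ 23 ∷ 5 ⟶ 4 ∷ 12 ⟶ 4 ∷ 4 ⟶ 23 ∷ 8 ⟶ 10 ∷ 11 ⟶ 10 ∷ 26 ⟶ 10 ∷
  10 ⟶ 23 ∷ 23 ↑ ∷
  19 ⟶ 27 ∷ 16 ⟶ 17 ∷ 17 ⟶ 27 ∷ 25 ⟶ 24 ∷ 24 ⟶ 27 ∷ 22 ⟶ 30 ∷ 30 ⟶ 27 ∷ 6 ⟶ 2 ∷ 18 ⟶ 2 ∷
  2 ⟶ 27 ∷ 27 ↑ ∷ []

script-8-5 : List (Step 5)
script-8-5 =
  16 ⟶ 0 ∷ 0 ⟶ 12 ∷ 7 ⟶ 5 ∷ 5 ⟶ 12 ∷ 8 ⟶ 10 ∷ 10 ⟶ 12 ∷ 24 ⟶ 26 ∷ 30 ⟶ 26 ∷ 26 ⟶ 12 ∷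
  12 ↑ ∷
  23 ⟶ 22 ∷ 3 ⟶ 2 ∷ 2 ⟶ 22 ∷ 6 ⟶ 4 ∷ 4 ⟶ 22 ∷ 18 ⟶ 19 ∷ 19 ⟶ 22 ∷ 11 ⟶ 15 ∷ 14 ⟶ 15 ∷
  15 ⟶ 22 ∷ 22 ↑ ∷
  29 ⟶ 28 ∷ 20 ⟶ 21 ∷ 21 ⟶ 28 ∷ 17 ⟶ 25 ∷ 25 ⟶ 28 ∷ 27 ⟶ 31 ∷ 31 ⟶ 28 ∷ 1 ⟶ 9 ∷ 13 ⟶ 9 ∷
  9 ⟶ 28 ∷ 28 ↑ ∷ []

script-9-5 : List (Step 5)
script-9-5 =
  18 ⟶ 2 ∷ 10 ⟶ 14 ∷ 14 ⟶ 2 ∷ 1 ⟶ 5 ∷ 4 ⟶ 5 ∷ 5 ⟶ 2 ∷ 13 ⟶ 12 ∷ 28 ⟶ 12 ∷ 12 ⟶ 2 ∷ 2 ↑ ∷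
  19 ⟶ 3 ∷ 9 ⟶ 8 ∷ 24 ⟶ 8 ∷ 8 ⟶ 3 ∷ 0 ⟶ 16 ∷ 17 ⟶ 16 ∷ 16 ⟶ 3 ∷ 23 ⟶ 22 ∷ 30 ⟶ 22 ∷
  22 ⟶ 3 ∷ 3 ↑ ∷
  7 ⟶ 6 ∷ 31 ⟶ 15 ∷ 15 ⟶ 6 ∷ 20 ⟶ 21 ∷ 29 ⟶ 21 ∷ 21 ⟶ 6 ∷ 11 ⟶ 27 ∷ 25 ⟶ 27 ∷ 26 ⟶ 27 ∷
  27 ⟶ 6 ∷ 6 ↑ ∷ []

script-10-5 : List (Step 5)
script-10-5 =
  1 ⟶ 17 ∷ 17 ⟶ 0 ∷ 6 ⟶ 22 ∷ 18 ⟶ 22 ∷ 22 ⟶ 0 ∷ 13 ⟶ 15 ∷ 14 ⟶ 15 ∷ 31 ⟶ 15 ∷ 15 ⟶ 0 ∷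
  0 ↑ ∷
  4 ⟶ 5 ∷ 21 ⟶ 5 ∷ 5 ⟶ 2 ∷ 7 ⟶ 23 ∷ 19 ⟶ 23 ∷ 23 ⟶ 2 ∷ 12 ⟶ 28 ∷ 20 ⟶ 28 ∷ 24 ⟶ 28 ∷
  28 ⟶ 2 ∷ 2 ↑ ∷
  9 ⟶ 8 ∷ 8 ⟶ 16 ∷ 29 ⟶ 25 ∷ 25 ⟶ 16 ∷ 30 ⟶ 26 ∷ 26 ⟶ 16 ∷ 3 ⟶ 11 ∷ 10 ⟶ 11 ∷ 27 ⟶ 11 ∷
  11 ⟶ 16 ∷ 16 ↑ ∷ []

script-10-6 : List (Step 6)
script-10-6 =
  6 ⟶ 2 ∷ 2 ⟶ 1 ∷ 20 ⟶ 16 ∷ 16 ⟶ 1 ∷ 17 ⟶ 49 ∷ 49 ⟶ 1 ∷ 48 ⟶ 50 ∷ 51 ⟶ 50 ∷ 58 ⟶ 50 ∷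
  50 ⟶ 1 ∷ 1 ↑ ∷
  22 ⟶ 30 ∷ 30 ⟶ 10 ∷ 9 ⟶ 25 ∷ 24 ⟶ 25 ∷ 25 ⟶ 10 ∷ 40 ⟶ 56 ∷ 60 ⟶ 56 ∷ 56 ⟶ 10 ∷
  46 ⟶ 62 ∷ 54 ⟶ 62 ∷ 62 ⟶ 10 ∷ 10 ↑ ∷
  28 ⟶ 29 ∷ 31 ⟶ 29 ∷ 26 ⟶ 27 ∷ 27 ⟶ 29 ∷ 55 ⟶ 63 ∷ 63 ⟶ 29 ∷ 3 ⟶ 19 ∷ 18 ⟶ 19 ∷
  19 ⟶ 29 ∷ 4 ⟶ 0 ∷ 8 ⟶ 0 ∷ 32 ⟶ 0 ∷ 0 ⟶ 29 ∷ 29 ↑ ∷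
  52 ⟶ 36 ∷ 44 ⟶ 45 ∷ 45 ⟶ 36 ∷ 7 ⟶ 15 ∷ 11 ⟶ 15 ∷ 13 ⟶ 15 ∷ 15 ⟶ 36 ∷ 41 ⟶ 43 ∷
  42 ⟶ 43 ∷ 59 ⟶ 43 ∷ 43 ⟶ 36 ∷ 36 ↑ ∷
  39 ⟶ 47 ∷ 12 ⟶ 14 ∷ 14 ⟶ 47 ∷ 33 ⟶ 37 ∷ 37 ⟶ 47 ∷ 57 ⟶ 61 ∷ 61 ⟶ 47 ∷ 35 ⟶ 34 ∷
  38 ⟶ 34 ∷ 34 ⟶ 47 ∷ 5 ⟶ 21 ∷ 23 ⟶ 21 ∷ 53 ⟶ 21 ∷ 21 ⟶ 47 ∷ 47 ↑ ∷ []

script-11-6 : List (Step 6)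
script-11-6 =
  37 ⟶ 45 ∷ 41 ⟶ 45 ∷ 45 ⟶ 1 ∷ 10 ⟶ 14 ∷ 12 ⟶ 14 ∷ 30 ⟶ 14 ∷ 14 ⟶ 1 ∷ 43 ⟶ 47 ∷
  46 ⟶ 47 ∷ 63 ⟶ 47 ∷ 47 ⟶ 1 ∷ 1 ↑ ∷
  32 ⟶ 0 ∷ 0 ⟶ 3 ∷ 31 ⟶ 15 ∷ 15 ⟶ 3 ∷ 55 ⟶ 39 ∷ 39 ⟶ 3 ∷ 20 ⟶ 21 ∷ 53 ⟶ 21 ∷ 21 ⟶ 3 ∷
  24 ⟶ 26 ∷ 58 ⟶ 26 ∷ 26 ⟶ 3 ∷ 3 ↑ ∷
  44 ⟶ 60 ∷ 61 ⟶ 60 ∷ 60 ⟶ 13 ∷ 2 ⟶ 34 ∷ 35 ⟶ 34 ∷ 42 ⟶ 34 ∷ 50 ⟶ 34 ∷ 34 ⟶ 13 ∷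
  22 ⟶ 54 ∷ 38 ⟶ 54 ∷ 52 ⟶ 54 ∷ 62 ⟶ 54 ∷ 54 ⟶ 13 ∷ 13 ↑ ∷
  48 ⟶ 16 ∷ 29 ⟶ 28 ∷ 28 ⟶ 16 ∷ 33 ⟶ 49 ∷ 49 ⟶ 16 ∷ 11 ⟶ 27 ∷ 25 ⟶ 27 ∷ 27 ⟶ 16 ∷
  56 ⟶ 57 ∷ 59 ⟶ 57 ∷ 57 ⟶ 16 ∷ 16 ↑ ∷
  4 ⟶ 5 ∷ 5 ⟶ 36 ∷ 7 ⟶ 6 ∷ 6 ⟶ 36 ∷ 9 ⟶ 8 ∷ 40 ⟶ 8 ∷ 8 ⟶ 36 ∷ 17 ⟶ 19 ∷ 18 ⟶ 19 ∷
  23 ⟶ 19 ∷ 51 ⟶ 19 ∷ 19 ⟶ 36 ∷ 36 ↑ ∷ []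

-- Rows in dimensions 0 to 6.

row₀ : Row 0 0 2
row₀ = by [] ∷ by (0 ↑ ∷ []) ∷ []

row₁ : Row 1 0 3
row₁ = cutRow row₀ ++ by (gatherAt gather₁ 1) ∷ by (gatherAt gather₁ 0) ∷ []

row₂ : Row 2 0 5
row₂ = cutRow row₁ ++
  by (gatherAt gather₂ 3) ∷ by (gatherAt gather₂ 1) ∷ by (gatherAt gather₂ 0) ∷ []

-- The index 4 is left out: the piles for (4 , 3) would have sizes among
-- 4, 5, 5, 5, 6, 6, 6, 7, none of which sum to 8.  For the same
-- reason (8 , 4), …, (11 , 4) and (11 , 5) are left out below.
upperRow₃ : Row 3 5 4
upperRow₃ =
  by (gatherAt gather₃ 7) ∷ by (gatherAt gather₃ 3) ∷
  by (gatherAt gather₃ 1) ∷ by (gatherAt gather₃ 0) ∷ []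

row₄ : Row 4 0 8
-- Cutting gives the indices 0 to 2 and 5 to 7. Cuts for 3 and 4 would use the missing (4 , 3), so
-- scripts supply them.
row₄ = cutRow (cutRow row₂) ++ by script-3-4 ∷ by script-4-4 ∷ cutRow upperRow₃

upperRow₄ : Row 4 12 5
upperRow₄ =
  by (gatherAt gather₄ 15) ∷ by (gatherAt gather₄ 7) ∷ by (gatherAt gather₄ 3) ∷
  by (gatherAt gather₄ 1) ∷ by (gatherAt gather₄ 0) ∷ []

row₅ : Row 5 0 11
row₅ = cutRow row₄ ++
  by script-7-5 ∷ by script-8-5 ∷ by script-9-5 ∷ by script-10-5 ∷ []

row₆ : Row 6 0 15
-- Cuts for 10 and 11 would both use the missing (11 , 5); two cuts of `upperRow₄` give 12 to 14.
row₆ = cutRow row₅ ++ by script-10-6 ∷ by script-11-6 ∷ cutRow (cutRow upperRow₄)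

stackable-between : ∀ {n l d} → Row n 0 (suc l) → n ≤ d → d ≤ n + l → Stackable d
stackable-between {n} {d = d} row n≤d d≤n+l = stackable
  (subst (Clearable 0) (m∸n+n≡m n≤d)
    (clearable-below row (d ∸ n) (m≤n+o⇒m∸n≤o d n d≤n+l)))

theorem8 : (d : ℕ) → d ≤ 20 → Stackable d
-- A row of `l + 1` entries in dimension `n` reaches every `d` from `n` to `n + l`: here 0 to 1, 2
-- to 6 and 6 to 20.
theorem8 d d≤20 with d ≤? 1 | d ≤? 6
... | yes d≤1 | _       = stackable-between row₀ z≤n d≤1
... | no  d≰1 | yes d≤6 = stackable-between row₂ (≰⇒> d≰1) d≤6
... | no  _   | no  d≰6 = stackable-between row₆ (<⇒≤ (≰⇒> d≰6)) d≤20
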